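{- Let $p$ and $q$ be positive integers with $p<q$. For every real $\varepsilon>0$ there is $n_0$ such that for every integer $n\ge n_0$ there exists a graph $G$ on $n$ vertices whose edge density $e(G)/\binom{n}{2}$ lies in $[p/q-\varepsilon,\,p/q+\varepsilon]$ and such that every vertex subset $U\subseteq V(G)$ with $|U|\ge \varepsilon n$ contains $q$ distinct vertices, any $p+1$ of which have fewer than $\varepsilon n$ common neighbors in $G$.
   Context: The paper phrases this asymptotically: "for sufficiently large $n$ there is an $n$-vertex graph with edge density $p/q+o(1)$ such that any subset $U$ of size $\Omega(n)$ contains $q$ vertices, any $p+1$ of which have at most $o(n)$ common neighbors"; the claim above is the quantified form of this asymptotic statement. -}

module Defs where

open import Data.Bool using (Bool; true; false; if_then_else_; _∧_)
open import Data.Nat using (ℕ; zero; suc; _+_; _<ᵇ_)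
open import Data.Fin using (Fin; zero; suc; toℕ)
open import Data.Integer using (+_)
open import Data.Rational using (ℚ; _/_)
open import Relation.Binary.PropositionalEquality using (_≡_)

countB : ∀ {n} → (Fin n → Bool) → ℕ
countB {zero} f = 0
countB {suc n} f = (if f zero then 1 else 0) + countB (λ i → f (suc i))

allB : ∀ {k} → (Fin k → Bool) → Bool
allB {zero} f = true
allB {suc k} f = f zero ∧ allB (λ i → f (suc i))

ℕ→ℚ : ℕ → ℚ
ℕ→ℚ n = + n / 1

record Graph (n : ℕ) : Set where
  field
    adj    : Fin n → Fin n → Bool
    sym    : ∀ i j → adj i j ≡ adj j i
    irrefl : ∀ i → adj i i ≡ false
open Graph public

edges : ∀ {n} → Graph n → ℕ
edges {n} G = sumF (λ i → countB (λ j → (toℕ i <ᵇ toℕ j) ∧ adj G i j))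
  where
  sumF : ∀ {m} → (Fin m → ℕ) → ℕ
  sumF {zero} f = 0
  sumF {suc m} f = f zero + sumF (λ i → f (suc i))

commonNbrs : ∀ {n k} → Graph n → (Fin k → Fin n) → ℕ
commonNbrs G w = countB (λ v → allB (λ j → adj G (w j) v))

module Submission where

-- Vertices are pairs of an offset a in Z/d and a word u in [q]^d; join (a , u) to (b , v) when the letter
-- u_{a+b} + v_{a+b} of Z/q is below p, and blow this up to n vertices by reducing indices modulo d q^d.  Every
-- row of the relation has density p/q.  If words u^i, i < q, agree with the rotations x + i of one word x on all
-- but t coordinates, then at every other coordinate j the letters u^i_j + v_j are distinct, so no p + 1 of them
-- are all below p; hence a common neighbour (b , v) of p + 1 of the vertices (a , u^i) has a + b among the t
-- exceptional coordinates, which happens for a fraction t/d of all vertices.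
-- A dense set of words W contains such words with t = O(√d): the Hamming distance f to W is 1-Lipschitz, so by
-- tensorization Var f ≤ d, and since f vanishes on W its mean is O(√d); now average Σ_i f(x + i) over x.

module Combinatorial where

  open import Defs hiding (sym)
  import Algebra.Properties.Semiring.Sum
  open import Data.Bool using (Bool; true; false; if_then_else_; not; _∧_)
  import Data.Bool.Properties as Bool
  open import Data.Fin using (Fin; zero; suc; toℕ; fromℕ<; combine; remQuot; _↑ˡ_; _↑ʳ_; _≟_)
  open import Data.Fin.Permutation using (Permutation; permutation; _⟨$⟩ˡ_; inverseˡ)
  open import Data.Fin.Properties
    using (any?; toℕ-injective; toℕ<n; toℕ-fromℕ<; toℕ-combine; remQuot-combine; injective⇒≤; fromℕ<-injective)
  open import Data.Fin.Subset using (Subset; _∈_; ∣_∣)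
  open import Data.Nat
    using (ℕ; zero; suc; _+_; _*_; _^_; _∸_; _≤_; _<_; _<ᵇ_; z≤n; s≤s; NonZero; >-nonZero; >-nonZero⁻¹; _/_; _%_)
  open import Data.Nat.Combinatorics using (_C_; nC1≡n; nCk+nC[k+1]≡[n+1]C[k+1])
  open import Data.Nat.DivMod
    using (_mod_; m%n<n; %-distribˡ-+; m%n%n≡m%n; [m+n]%n≡m%n; [m+kn]%n≡m%n; m<n⇒m%n≡m; m≡m%n+[m/n]*n; m/n*n≤m)
  open import Data.Nat.Properties hiding (_≟_)
  open import Data.Nat.Tactic.RingSolver using (solve-∀)
  open import Data.Product using (Σ; ∃; _×_; _,_; proj₁; proj₂)
  open import Data.Product.Properties using (≡-dec; ,-injectiveʳ)
  open import Data.Sum using (inj₁; inj₂)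
  open import Data.Vec using (Vec; []; _∷_; lookup; map)
  open import Data.Vec.Properties using (lookup-map; lookup⇒[]=)
  open import Function using (_∘_; Equivalence)
  open import Function.Definitions using (Injective)
  open import Relation.Binary.PropositionalEquality
    using (_≡_; refl; sym; trans; cong; cong₂; subst; module ≡-Reasoning)
  open import Relation.Nullary using (Dec; yes; no; contradiction)
  open import Relation.Nullary.Decidable using (⌊_⌋; _×-dec_)

  open Algebra.Properties.Semiring.Sum +-*-semiring

  -- Sums over Fin

  χ : Bool → ℕ
  χ b = if b then 1 else 0

  countB-sum : ∀ {n} (f : Fin n → Bool) → countB f ≡ ∑[ i < n ] χ (f i)
  countB-sum {zero}  f = refl
  countB-sum {suc n} f = cong (χ (f zero) +_) (countB-sum (f ∘ suc))

  sum-mono : ∀ {n} {f g : Fin n → ℕ} → (∀ i → f i ≤ g i) → sum f ≤ sum g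
  sum-mono {zero}  f≤g = z≤n
  sum-mono {suc n} f≤g = +-mono-≤ (f≤g zero) (sum-mono (f≤g ∘ suc))

  sum-const : ∀ n c → ∑[ i < n ] c ≡ n * c
  sum-const zero    c = refl
  sum-const (suc n) c = cong (c +_) (sum-const n c)

  sum-+ : ∀ n (f g : Fin n → ℕ) → ∑[ i < n ] (f i + g i) ≡ sum f + sum g
  sum-+ n = ∑-distrib-+ {n}

  sum-affine : ∀ n c k (f : Fin n → ℕ) → ∑[ i < n ] (c * f i + k) ≡ c * sum f + n * k
  sum-affine n c k f =
    trans (sum-+ n (λ i → c * f i) (λ _ → k)) (cong₂ _+_ (sym (*-distribˡ-sum c f)) (sum-const n k))

  sum-+const : ∀ n k (f : Fin n → ℕ) → ∑[ i < n ] (f i + k) ≡ sum f + n * k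
  sum-+const n k f = trans (sum-+ n f (λ _ → k)) (cong (sum f +_) (sum-const n k))

  term≤sum : ∀ {n} (f : Fin n → ℕ) i → f i ≤ sum f
  term≤sum f zero    = m≤m+n _ _
  term≤sum f (suc i) = ≤-trans (term≤sum (f ∘ suc) i) (m≤n+m _ _)

  -- Averaging: if `g i + 1 ≤ f i` held for every `i`, summing would give `sum g + n ≤ sum f`,
  -- impossible for `n > 0`.
  sum-≤⇒∃≤ : ∀ {n} .{{_ : NonZero n}} (f g : Fin n → ℕ) → sum f ≤ sum g → ∃ λ i → f i ≤ g i
  sum-≤⇒∃≤ {suc n} f g f≤g with any? (λ i → f i ≤? g i)
  ... | yes found = found
  ... | no  none  = contradiction f≤g (<⇒≱ (≤-trans (s≤s (m≤n+m (sum g) n)) (begin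
    suc n + sum g                 ≡⟨ +-comm (suc n) (sum g) ⟩
    sum g + suc n                 ≡⟨ cong (sum g +_) (*-identityʳ (suc n)) ⟨
    sum g + suc n * 1             ≡⟨ sum-+const (suc n) 1 g ⟨
    ∑[ i < suc n ] (g i + 1)      ≤⟨ sum-mono (λ i → ≤-trans (≤-reflexive (+-comm (g i) 1)) (≰⇒> (λ fi≤gi → none (i , fi≤gi)))) ⟩
    sum f                         ∎)))
    where open ≤-Reasoning

  sum-↑ : ∀ m {n} (h : Fin (m + n) → ℕ) →
          sum h ≡ ∑[ i < m ] h (i ↑ˡ n) + ∑[ j < n ] h (m ↑ʳ j)
  sum-↑ zero    h = refl
  sum-↑ (suc m) h = trans (cong (h zero +_) (sum-↑ m (h ∘ suc))) (sym (+-assoc (h zero) _ _))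

  sum-combine : ∀ m n (h : Fin (m * n) → ℕ) →
                sum h ≡ ∑[ i < m ] ∑[ j < n ] h (combine i j)
  sum-combine zero    n h = refl
  sum-combine (suc m) n h =
    trans (sum-↑ n h) (cong (∑[ j < n ] h (j ↑ˡ (m * n)) +_) (sum-combine m n (h ∘ (n ↑ʳ_))))

  sum-toℕ-mono : ∀ {m n} (H : ℕ → ℕ) → m ≤ n → ∑[ i < m ] H (toℕ i) ≤ ∑[ i < n ] H (toℕ i)
  sum-toℕ-mono H z≤n       = z≤n
  sum-toℕ-mono H (s≤s m≤n) = +-monoʳ-≤ (H 0) (sum-toℕ-mono (H ∘ suc) m≤n)

  module _ {M : ℕ} .{{_ : NonZero M}} (H : Fin M → ℕ) where

    -- `k` full periods meet each residue exactly `k` times; `combine` splits the index range into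
    -- these periods.
    sum-mod-* : ∀ k → ∑[ i < k * M ] H (toℕ i mod M) ≡ k * sum H
    sum-mod-* k = begin
      ∑[ i < k * M ] H (toℕ i mod M)                       ≡⟨ sum-combine k M _ ⟩
      ∑[ i < k ] ∑[ j < M ] H (toℕ (combine i j) mod M)    ≡⟨ sum-cong-≗ (λ i → sum-cong-≗ (λ j → cong H (residue i j))) ⟩
      ∑[ i < k ] sum H                                     ≡⟨ sum-const k _ ⟩
      k * sum H                                            ∎
      where
      open ≡-Reasoning
      residue : ∀ (i : Fin k) (j : Fin M) → toℕ (combine i j) mod M ≡ j
      residue i j = toℕ-injective (begin
        toℕ (toℕ (combine i j) mod M)   ≡⟨ toℕ-fromℕ< _ ⟩
        toℕ (combine i j) % M           ≡⟨ cong (_% M) (toℕ-combine i j) ⟩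
        (M * toℕ i + toℕ j) % M         ≡⟨ cong (_% M) (trans (+-comm (M * toℕ i) _) (cong (toℕ j +_) (*-comm M _))) ⟩
        (toℕ j + toℕ i * M) % M         ≡⟨ [m+kn]%n≡m%n (toℕ j) (toℕ i) M ⟩
        toℕ j % M                       ≡⟨ m<n⇒m%n≡m (toℕ<n j) ⟩
        toℕ j                           ∎)

    sum-mod-≤ : ∀ {n} k → n ≤ k * M → ∑[ i < n ] H (toℕ i mod M) ≤ k * sum H
    sum-mod-≤ k n≤kM = ≤-trans (sum-toℕ-mono (λ i → H (i mod M)) n≤kM) (≤-reflexive (sum-mod-* k))

    sum-mod-≥ : ∀ {n} k → k * M ≤ n → k * sum H ≤ ∑[ i < n ] H (toℕ i mod M)
    sum-mod-≥ k kM≤n = ≤-trans (≤-reflexive (sym (sum-mod-* k))) (sum-toℕ-mono (λ i → H (i mod M)) kM≤n)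

  -- Supplies a nearest word in a nonempty set: `P` is the set and `h` the distance.
  argmin : ∀ {n} (P : Fin n → Bool) (h : Fin n → ℕ) → ∃ (λ i → P i ≡ true) →
           ∃ λ i → P i ≡ true × (∀ j → P j ≡ true → h i ≤ h j)
  argmin {suc n} P h inhabited with any? (λ i → P (suc i) Bool.≟ true)
  argmin {suc n} P h (zero  , P0) | no none =
    zero , P0 , λ { zero _ → ≤-refl ; (suc j) Pj → contradiction (j , Pj) none }
  argmin {suc n} P h (suc i , Pi) | no none = contradiction (i , Pi) none
  argmin {suc n} P h _ | yes tail with argmin (P ∘ suc) (h ∘ suc) tail | P zero in P0
  ... | m , Pm , min | false =
    suc m , Pm , λ { zero Pz → contradiction (trans (sym P0) Pz) (λ ()) ; (suc j) Pj → min j Pj }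
  ... | m , Pm , min | true with ≤-total (h zero) (h (suc m))
  ...   | inj₁ h0≤hm = zero , P0 , λ { zero _ → ≤-refl ; (suc j) Pj → ≤-trans h0≤hm (min j Pj) }
  ...   | inj₂ hm≤h0 = suc m , Pm , λ { zero _ → hm≤h0 ; (suc j) Pj → min j Pj }

  -- Addition modulo `q`

  module _ {q : ℕ} .{{_ : NonZero q}} where

    infixl 6 _⊕_
    _⊕_ : Fin q → Fin q → Fin q
    a ⊕ b = (toℕ a + toℕ b) mod q

    ⊕-comm : ∀ a b → a ⊕ b ≡ b ⊕ a
    ⊕-comm a b = cong (_mod q) (+-comm (toℕ a) (toℕ b))

    private
      shift-back : ∀ x y (b : Fin q) → x + y ≡ q → (x + (y + toℕ b) % q) % q ≡ toℕ b
      shift-back x y b x+y≡q = begin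
        (x + (y + toℕ b) % q) % q               ≡⟨ %-distribˡ-+ x _ q ⟩
        (x % q + (y + toℕ b) % q % q) % q       ≡⟨ cong (λ z → (x % q + z) % q) (m%n%n≡m%n (y + toℕ b) q) ⟩
        (x % q + (y + toℕ b) % q) % q           ≡⟨ %-distribˡ-+ x _ q ⟨
        (x + (y + toℕ b)) % q                   ≡⟨ cong (_% q) (trans (sym (+-assoc x y _)) (trans (cong (_+ toℕ b) x+y≡q) (+-comm q _))) ⟩
        (toℕ b + q) % q                         ≡⟨ [m+n]%n≡m%n (toℕ b) q ⟩
        toℕ b % q                               ≡⟨ m<n⇒m%n≡m (toℕ<n b) ⟩
        toℕ b                                   ∎
        where open ≡-Reasoning

    -- As a permutation, translation gives both the invariance of sums, through `sum-permute`, and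
    -- the cancellation laws, through its left inverse. The inverse adds `q ∸ a`, which represents
    -- `- a`.
    translate : Fin q → Permutation q q
    translate a = permutation (a ⊕_) (λ b → (q ∸ toℕ a + toℕ b) mod q)
      (λ b → inverse (toℕ a) (q ∸ toℕ a) b (m+[n∸m]≡n (<⇒≤ (toℕ<n a))))
      (λ b → inverse (q ∸ toℕ a) (toℕ a) b (m∸n+n≡m (<⇒≤ (toℕ<n a))))
      where
      inverse : ∀ x y b → x + y ≡ q → (x + toℕ ((y + toℕ b) mod q)) mod q ≡ b
      inverse x y b x+y≡q = toℕ-injective
        (trans (toℕ-fromℕ< _) (trans (cong (λ z → (x + z) % q) (toℕ-fromℕ< _)) (shift-back x y b x+y≡q)))

    ⊕-cancelˡ : ∀ a {b c} → a ⊕ b ≡ a ⊕ c → b ≡ c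
    ⊕-cancelˡ a eq = trans (sym (inverseˡ (translate a))) (trans (cong (translate a ⟨$⟩ˡ_) eq) (inverseˡ (translate a)))

    ⊕-cancelʳ : ∀ a {b c} → b ⊕ a ≡ c ⊕ a → b ≡ c
    ⊕-cancelʳ a {b} {c} eq = ⊕-cancelˡ a (trans (⊕-comm a b) (trans eq (⊕-comm c a)))

    sum-⊕ : ∀ (f : Fin q → ℕ) a → ∑[ c < q ] f (a ⊕ c) ≡ sum f
    sum-⊕ f a = sym (sum-permute f (translate a))

  sum-<ᵇ : ∀ {p q} → p ≤ q → ∑[ c < q ] χ (toℕ c <ᵇ p) ≡ p
  sum-<ᵇ {zero}  {q}     _         = trans (sum-const q 0) (*-zeroʳ q)
  sum-<ᵇ {suc p} {suc q} (s≤s p≤q) = cong suc (sum-<ᵇ p≤q)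

  -- Words and Hamming distance

  _≠ᵇ_ : ∀ {q} → Fin q → Fin q → Bool
  a ≠ᵇ b = not ⌊ a ≟ b ⌋

  ≠ᵇ-irrefl : ∀ {q} (a : Fin q) → a ≠ᵇ a ≡ false
  ≠ᵇ-irrefl a with a ≟ a
  ... | yes _ = refl
  ... | no a≢a = contradiction refl a≢a

  χ≤1 : ∀ b → χ b ≤ 1
  χ≤1 false = z≤n
  χ≤1 true  = ≤-refl

  hamming : ∀ {q d} → Vec (Fin q) d → Vec (Fin q) d → ℕ
  hamming {d = d} x y = ∑[ j < d ] χ (lookup x j ≠ᵇ lookup y j)

  hamming-refl : ∀ {q d} (x : Vec (Fin q) d) → hamming x x ≡ 0
  hamming-refl {d = d} x = trans (sum-cong-≗ (λ j → cong χ (≠ᵇ-irrefl (lookup x j)))) (sum-replicate-zero d)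

  hamming-triangle : ∀ {q d} (x y z : Vec (Fin q) d) → hamming x z ≤ hamming x y + hamming y z
  hamming-triangle {d = d} x y z =
    ≤-trans (sum-mono (λ j → letter (lookup x j) (lookup y j) (lookup z j)))
            (≤-reflexive (sum-+ d (λ j → χ (lookup x j ≠ᵇ lookup y j)) _))
    where
    letter : ∀ {q} (a b c : Fin q) → χ (a ≠ᵇ c) ≤ χ (a ≠ᵇ b) + χ (b ≠ᵇ c)
    letter a b c with a ≟ b
    ... | yes refl = ≤-refl
    ... | no  _    = ≤-trans (χ≤1 (a ≠ᵇ c)) (m≤m+n 1 _)

  -- Ranging over both orders of `x` and `y`, this one-sided form bounds the absolute difference
  -- without subtraction in ℕ.
  Lipschitz : ∀ {q d} → (Vec (Fin q) d → ℕ) → Set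
  Lipschitz f = ∀ x y → f x ≤ f y + hamming x y

  module _ {q : ℕ} where

    -- Base-`q` digits, first letter most significant: averages over words become sums over `Fin`,
    -- and induction on the length peels off the first letter.
    word : ∀ d → Fin (q ^ d) → Vec (Fin q) d
    word zero    _ = []
    word (suc d) i = proj₁ (remQuot {q} (q ^ d) i) ∷ word d (proj₂ (remQuot {q} (q ^ d) i))

    word-combine : ∀ d c i → word (suc d) (combine c i) ≡ c ∷ word d i
    word-combine d c i = cong (λ s → proj₁ s ∷ word d (proj₂ s)) (remQuot-combine c i)

    sum-word-suc : ∀ d (g : Vec (Fin q) (suc d) → ℕ) →
                   ∑[ i < q ^ suc d ] g (word (suc d) i) ≡ ∑[ c < q ] ∑[ i < q ^ d ] g (c ∷ word d i)
    sum-word-suc d g = trans (sum-combine q (q ^ d) _)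
      (sum-cong-≗ (λ c → sum-cong-≗ (λ i → cong g (word-combine d c i))))

    -- A single coordinate of a uniformly random word is a uniformly random letter; the factor `q`
    -- on the left replaces a division on the right.
    sum-letter : ∀ {d} j (h : Fin q → ℕ) → q * ∑[ i < q ^ d ] h (lookup (word d i) j) ≡ q ^ d * sum h
    sum-letter {suc d} zero h = begin
      q * ∑[ i < q ^ suc d ] h (lookup (word (suc d) i) zero)  ≡⟨ cong (q *_) (sum-word-suc d (λ x → h (lookup x zero))) ⟩
      q * ∑[ c < q ] ∑[ i < q ^ d ] h c                        ≡⟨ cong (q *_) (sum-cong-≗ (λ c → sum-const (q ^ d) (h c))) ⟩
      q * ∑[ c < q ] (q ^ d * h c)                             ≡⟨ cong (q *_) (*-distribˡ-sum (q ^ d) h) ⟨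
      q * (q ^ d * sum h)                                      ≡⟨ *-assoc q _ _ ⟨
      q ^ suc d * sum h                                        ∎
      where open ≡-Reasoning
    sum-letter {suc d} (suc j) h = begin
      q * ∑[ i < q ^ suc d ] h (lookup (word (suc d) i) (suc j))  ≡⟨ cong (q *_) (sum-word-suc d (λ x → h (lookup x (suc j)))) ⟩
      q * ∑[ c < q ] ∑[ i < q ^ d ] h (lookup (word d i) j)       ≡⟨ cong (q *_) (sum-const q _) ⟩
      q * (q * ∑[ i < q ^ d ] h (lookup (word d i) j))            ≡⟨ cong (q *_) (sum-letter j h) ⟩
      q * (q ^ d * sum h)                                         ≡⟨ *-assoc q _ _ ⟨
      q ^ suc d * sum h                                           ∎
      where open ≡-Reasoning

  -- Variance of Lipschitz functions on words

  -- (a - b)² ≤ M², with both sides moved so that no subtraction occurs.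
  square-gap : ∀ {a b M} → a ≤ b + M → b ≤ a + M → a * a + b * b ≤ 2 * (a * b) + M * M
  square-gap {a} {b} {M} a≤b+M b≤a+M with ≤-total a b
  ... | inj₁ a≤b with m≤n⇒∃[o]m+o≡n a≤b
  ...   | t , refl = ≤-trans (≤-reflexive (identity a t)) (+-monoʳ-≤ (2 * (a * (a + t))) (*-mono-≤ t≤M t≤M))
    where
    t≤M = +-cancelˡ-≤ a _ _ b≤a+M
    identity : ∀ a t → a * a + (a + t) * (a + t) ≡ 2 * (a * (a + t)) + t * t
    identity = solve-∀
  square-gap {a} {b} {M} a≤b+M b≤a+M | inj₂ b≤a with m≤n⇒∃[o]m+o≡n b≤a
  ...   | t , refl = ≤-trans (≤-reflexive (identity b t)) (+-monoʳ-≤ (2 * ((b + t) * b)) (*-mono-≤ t≤M t≤M))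
    where
    t≤M = +-cancelˡ-≤ b _ _ a≤b+M
    identity : ∀ b t → (b + t) * (b + t) + b * b ≡ 2 * ((b + t) * b) + t * t
    identity = solve-∀

  sum-*-sum : ∀ {m n} (f : Fin m → ℕ) (g : Fin n → ℕ) → ∑[ i < m ] ∑[ j < n ] (f i * g j) ≡ sum f * sum g
  sum-*-sum f g = trans (sum-cong-≗ (λ i → sym (*-distribˡ-sum (f i) g))) (sym (*-distribʳ-sum (sum g) f))

  -- Numbers within `M` of each other have variance O(M²): summing `square-gap` over all pairs of
  -- letters gives `2 q Σ a² ≤ 2 (Σ a)² + q² M²`.
  variance-step : ∀ {q} (a : Fin q → ℕ) {M} → (∀ c c′ → a c ≤ a c′ + M) →
                  q * ∑[ c < q ] (a c * a c) ≤ sum a * sum a + q * q * (M * M)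
  variance-step {q} a {M} gap = *-cancelˡ-≤ 2 (begin
    2 * (q * S)                                                  ≡⟨ cong (q * S +_) (+-identityʳ (q * S)) ⟩
    q * S + q * S                                                ≡⟨ sum-affine q q S (λ c → a c * a c) ⟨
    ∑[ c < q ] (q * (a c * a c) + S)                             ≡⟨ sum-cong-≗ {q} (λ c → trans (sum-+const q (a c * a c) (λ c′ → a c′ * a c′)) (+-comm S _)) ⟨
    ∑[ c < q ] ∑[ c′ < q ] (a c′ * a c′ + a c * a c)             ≤⟨ sum-mono (λ c → sum-mono (λ c′ → square-gap (gap c′ c) (gap c c′))) ⟩
    ∑[ c < q ] ∑[ c′ < q ] (2 * (a c′ * a c) + M * M)            ≡⟨ sum-cong-≗ {q} (λ c → sum-affine q 2 (M * M) (λ c′ → a c′ * a c)) ⟩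
    ∑[ c < q ] (2 * ∑[ c′ < q ] (a c′ * a c) + q * (M * M))      ≡⟨ sum-affine q 2 (q * (M * M)) (λ c → ∑[ c′ < q ] (a c′ * a c)) ⟩
    2 * ∑[ c < q ] ∑[ c′ < q ] (a c′ * a c) + q * (q * (M * M))  ≡⟨ cong₂ (λ x y → 2 * x + y) (trans (∑-comm (λ c c′ → a c′ * a c)) (sum-*-sum a a)) (sym (*-assoc q q _)) ⟩
    -- The error term is doubled so that the common factor 2 cancels.
    2 * (sum a * sum a) + q * q * (M * M)                        ≤⟨ +-monoʳ-≤ (2 * (sum a * sum a)) (m≤n*m _ 2) ⟩
    2 * (sum a * sum a) + 2 * (q * q * (M * M))                  ≡⟨ *-distribˡ-+ 2 (sum a * sum a) _ ⟨
    2 * (sum a * sum a + q * q * (M * M))                        ∎)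
    where
    open ≤-Reasoning
    S = ∑[ c < q ] (a c * a c)

  module _ {q : ℕ} where

    -- This is `Var f ≤ d` multiplied by `N²`. Words are split by their first letter: inside each
    -- slice the variance is bounded by induction, and the slice sums `A c` differ pairwise by at
    -- most the slice size, so `variance-step` charges one more unit for the first letter.
    variance : ∀ d (f : Vec (Fin q) d → ℕ) → Lipschitz f →
               let N = q ^ d ; A = ∑[ i < N ] f (word d i) in
               N * ∑[ i < N ] (f (word d i) * f (word d i)) ≤ A * A + d * (N * N)
    variance zero f _ = ≤-reflexive (base (f []))
      where
      base : ∀ a → 1 * (a * a + 0) ≡ (a + 0) * (a + 0) + 0
      base = solve-∀
    variance (suc d) f lip = begin
      q * N * ∑[ i < q * N ] (f (word (suc d) i) * f (word (suc d) i))  ≡⟨ cong (q * N *_) (sum-word-suc d (λ x → f x * f x)) ⟩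
      q * N * ∑[ c < q ] S c                       ≡⟨ *-assoc q N _ ⟩
      q * (N * ∑[ c < q ] S c)                     ≡⟨ cong (q *_) (*-distribˡ-sum N S) ⟩
      q * ∑[ c < q ] (N * S c)                     ≤⟨ *-monoʳ-≤ q (sum-mono (λ c → variance d (f ∘ (c ∷_)) (slice-lip c))) ⟩
      q * ∑[ c < q ] (A c * A c + d * (N * N))     ≡⟨ cong (q *_) (sum-+const q (d * (N * N)) (λ c → A c * A c)) ⟩
      q * (∑[ c < q ] (A c * A c) + q * (d * (N * N)))  ≡⟨ *-distribˡ-+ q (∑[ c < q ] (A c * A c)) _ ⟩
      q * ∑[ c < q ] (A c * A c) + q * (q * (d * (N * N)))  ≤⟨ +-monoˡ-≤ (q * (q * (d * (N * N)))) (variance-step A gap) ⟩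
      sum A * sum A + q * q * (N * N) + q * (q * (d * (N * N)))  ≡⟨ regroup (sum A * sum A) q N d ⟩
      sum A * sum A + suc d * (q * N * (q * N))    ≡⟨ cong (λ z → z * z + suc d * (q * N * (q * N))) (sum-word-suc d f) ⟨
      _ ∎
      where
      open ≤-Reasoning
      N = q ^ d
      A S : Fin q → ℕ
      A c = ∑[ i < N ] f (c ∷ word d i)
      S c = ∑[ i < N ] (f (c ∷ word d i) * f (c ∷ word d i))
      slice-lip : ∀ c → Lipschitz (f ∘ (c ∷_))
      slice-lip c x y = ≤-trans (lip (c ∷ x) (c ∷ y))
        (≤-reflexive (cong (λ b → f (c ∷ y) + (χ b + hamming x y)) (≠ᵇ-irrefl c)))
      -- Changing the first letter moves a word by Hamming distance at most 1, hence each of the `N`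
      -- terms by at most 1.
      gap : ∀ c c′ → A c ≤ A c′ + N
      gap c c′ = begin
        A c                                   ≤⟨ sum-mono (λ i → ≤-trans (lip (c ∷ word d i) (c′ ∷ word d i)) (+-monoʳ-≤ (f (c′ ∷ word d i)) (≤-trans (+-mono-≤ (χ≤1 (c ≠ᵇ c′)) (≤-reflexive (hamming-refl (word d i)))) ≤-refl))) ⟩
        ∑[ i < N ] (f (c′ ∷ word d i) + 1)    ≡⟨ sum-+const N 1 (λ i → f (c′ ∷ word d i)) ⟩
        A c′ + N * 1                          ≡⟨ cong (A c′ +_) (*-identityʳ N) ⟩
        A c′ + N                              ∎
      regroup : ∀ a q N d → a + q * q * (N * N) + q * (q * (d * (N * N))) ≡ a + (1 + d) * (q * N * (q * N))
      regroup = solve-∀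

  2ab≤a²+b² : ∀ a b → 2 * (a * b) ≤ a * a + b * b
  2ab≤a²+b² a b with ≤-total a b
  ... | inj₁ a≤b with m≤n⇒∃[o]m+o≡n a≤b
  ...   | t , refl = ≤-trans (m≤m+n _ (t * t)) (≤-reflexive (identity a t))
    where
    identity : ∀ a t → 2 * (a * (a + t)) + t * t ≡ a * a + (a + t) * (a + t)
    identity = solve-∀
  2ab≤a²+b² a b | inj₂ b≤a with m≤n⇒∃[o]m+o≡n b≤a
  ...   | t , refl = ≤-trans (m≤m+n _ (t * t)) (≤-reflexive (identity b t))
    where
    identity : ∀ b t → 2 * ((b + t) * b) + t * t ≡ (b + t) * (b + t) + b * b
    identity = solve-∀

  module _ {q : ℕ} where

    -- Chebyshev: on `W` the function differs from its mean `A / N` by exactly `A / N`, so the sum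
    -- of `(N f - A)²` is at least `A²` times the size of `W`; by `variance` it is at most `d N³`.
    zero-set-bound : ∀ d (f : Vec (Fin q) d → ℕ) → Lipschitz f → (W : Fin (q ^ d) → Bool) →
                     (∀ i → W i ≡ true → f (word d i) ≡ 0) →
                     let N = q ^ d ; A = ∑[ i < N ] f (word d i) in
                     ∑[ i < N ] χ (W i) * (A * A) ≤ d * (N * (N * N))
    zero-set-bound d f lip W f≡0 = +-cancelʳ-≤ (N * (A * A) + N * (A * A)) _ _ (begin
      w * (A * A) + (N * (A * A) + N * (A * A))                      ≡⟨ cong (w * (A * A) +_) (double N A) ⟩
      w * (A * A) + 2 * (N * A) * A                                  ≡⟨ cong₂ _+_ (*-distribʳ-sum (A * A) (χ ∘ W)) (*-distribˡ-sum (2 * (N * A)) F) ⟩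
      ∑[ i < N ] (χ (W i) * (A * A)) + ∑[ i < N ] (2 * (N * A) * F i) ≡⟨ sum-+ N (λ i → χ (W i) * (A * A)) _ ⟨
      ∑[ i < N ] (χ (W i) * (A * A) + 2 * (N * A) * F i)             ≤⟨ sum-mono pointwise ⟩
      ∑[ i < N ] (N * N * (F i * F i) + A * A)                       ≡⟨ sum-affine N (N * N) (A * A) (λ i → F i * F i) ⟩
      N * N * ∑[ i < N ] (F i * F i) + N * (A * A)                   ≡⟨ cong (_+ N * (A * A)) (*-assoc N N _) ⟩
      N * (N * ∑[ i < N ] (F i * F i)) + N * (A * A)                 ≤⟨ +-monoˡ-≤ (N * (A * A)) (*-monoʳ-≤ N (variance d f lip)) ⟩
      N * (A * A + d * (N * N)) + N * (A * A)                        ≡⟨ regroup N A d ⟩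
      d * (N * (N * N)) + (N * (A * A) + N * (A * A))                ∎)
      where
      open ≤-Reasoning
      N = q ^ d
      F : Fin N → ℕ
      F i = f (word d i)
      A = sum F
      w = ∑[ i < N ] χ (W i)
      double : ∀ N A → N * (A * A) + N * (A * A) ≡ 2 * (N * A) * A
      double = solve-∀
      regroup : ∀ N A d → N * (A * A + d * (N * N)) + N * (A * A) ≡ d * (N * (N * N)) + (N * (A * A) + N * (A * A))
      regroup = solve-∀
      off : ∀ x → 2 * (N * A) * x ≤ N * N * (x * x) + A * A
      off x = ≤-trans (≤-reflexive (product N A x))
                (≤-trans (2ab≤a²+b² (N * x) A) (≤-reflexive (cong (_+ A * A) (squares N x))))
        where
        product : ∀ N A x → 2 * (N * A) * x ≡ 2 * (N * x * A)
        product = solve-∀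
        squares : ∀ N x → N * x * (N * x) ≡ N * N * (x * x)
        squares = solve-∀
      -- This is `χ (W i) A² ≤ (N F i - A)²` with the cross term moved to the left: an equality on
      -- `W`, where `F i = 0`, and nonnegativity of a square elsewhere.
      pointwise : ∀ i → χ (W i) * (A * A) + 2 * (N * A) * F i ≤ N * N * (F i * F i) + A * A
      pointwise i with W i in Wi
      ... | false = off (F i)
      ... | true rewrite f≡0 i Wi = ≤-reflexive (on N A)
        where
        on : ∀ N A → 1 * (A * A) + 2 * (N * A) * 0 ≡ N * N * 0 + A * A
        on = solve-∀

  -- Rotations of words and dense sets

  module _ {q : ℕ} .{{_ : NonZero q}} where

    rotate : ∀ {d} → Fin q → Vec (Fin q) d → Vec (Fin q) d
    rotate i = map (i ⊕_)

    -- Rotation permutes the words; treating one letter at a time reduces this to translation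
    -- invariance on `Fin q`.
    sum-rotate : ∀ d i (f : Vec (Fin q) d → ℕ) →
                 ∑[ r < q ^ d ] f (rotate i (word d r)) ≡ ∑[ r < q ^ d ] f (word d r)
    sum-rotate zero    i f = refl
    sum-rotate (suc d) i f = begin
      ∑[ r < q ^ suc d ] f (rotate i (word (suc d) r))                   ≡⟨ sum-word-suc d (f ∘ rotate i) ⟩
      ∑[ c < q ] ∑[ r < q ^ d ] f (i ⊕ c ∷ rotate i (word d r))          ≡⟨ sum-cong-≗ (λ c → sum-rotate d i (f ∘ (i ⊕ c ∷_))) ⟩
      ∑[ c < q ] ∑[ r < q ^ d ] f (i ⊕ c ∷ word d r)                     ≡⟨ sum-⊕ (λ c → ∑[ r < q ^ d ] f (c ∷ word d r)) i ⟩
      ∑[ c < q ] ∑[ r < q ^ d ] f (c ∷ word d r)                         ≡⟨ sum-word-suc d f ⟨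
      ∑[ r < q ^ suc d ] f (word (suc d) r)                              ∎
      where open ≡-Reasoning

    -- The word `x` is chosen with at most average total distance from its `q` rotations to `W`, and
    -- `u i` indexes a word of `W` nearest to `rotate i x`. Rotations preserve the sum `A` of all
    -- distances, so the average is `q A / N`, while `zero-set-bound` and density `1 / k` give
    -- `A² ≤ k d N²`.
    dense⇒near-orbit : ∀ d k (W : Fin (q ^ d) → Bool) → q ^ d ≤ k * ∑[ i < q ^ d ] χ (W i) →
      ∃ λ x → Σ (Fin q → Fin (q ^ d)) λ u → (∀ i → W (u i) ≡ true) ×
        (let t = ∑[ i < q ] hamming (rotate i x) (word d (u i)) in t * t ≤ k * (q * q * d))
    dense⇒near-orbit d k W dense = x , (λ i → proj₁ (near (rotate i x))) , (λ i → proj₁ (proj₂ (near (rotate i x)))) , t-bound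
      where
      N = q ^ d
      w = ∑[ i < N ] χ (W i)
      instance
        N≢0 : NonZero N
        N≢0 = m^n≢0 q d
        N³≢0 : NonZero (N * (N * N))
        N³≢0 = m*n≢0 N (N * N) {{N≢0}} {{m*n≢0 N N}}
      inhabited : ∃ λ i → W i ≡ true
      inhabited with sum-≤⇒∃≤ {N} (λ _ → 1) (λ i → k * χ (W i))
        (≤-trans (≤-reflexive (trans (sum-const N 1) (*-identityʳ N))) (≤-trans dense (≤-reflexive (*-distribˡ-sum k (χ ∘ W)))))
      ... | i , 1≤kχ with W i in Wi
      ...   | true  = i , Wi
      ...   | false = contradiction (≤-trans 1≤kχ (≤-reflexive (*-zeroʳ k))) (λ ())
      near : ∀ y → ∃ λ i → W i ≡ true × (∀ j → W j ≡ true → hamming y (word d i) ≤ hamming y (word d j))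
      near y = argmin W (λ i → hamming y (word d i)) inhabited
      dist : Vec (Fin q) d → ℕ
      dist y = hamming y (word d (proj₁ (near y)))
      dist-lip : Lipschitz dist
      -- The word of `W` nearest to `z` is also a candidate for `y`, and the triangle inequality
      -- compares the two distances.
      dist-lip y z with near z | near y
      ... | j , Wj , _ | _ , _ , min =
        ≤-trans (min j Wj) (≤-trans (hamming-triangle y z (word d j)) (≤-reflexive (+-comm (hamming y z) _)))
      dist≡0 : ∀ i → W i ≡ true → dist (word d i) ≡ 0
      dist≡0 i Wi = n≤0⇒n≡0 (≤-trans (proj₂ (proj₂ (near (word d i))) i Wi) (≤-reflexive (hamming-refl (word d i))))
      A = ∑[ r < N ] dist (word d r)
      total : Fin N → ℕ
      total r = ∑[ i < q ] dist (rotate i (word d r))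
      average : ∃ λ r → N * total r ≤ q * A
      average = sum-≤⇒∃≤ {N} (λ r → N * total r) (λ _ → q * A) (≤-reflexive (begin
        ∑[ r < N ] (N * total r)                                     ≡⟨ *-distribˡ-sum N total ⟨
        N * ∑[ r < N ] ∑[ i < q ] dist (rotate i (word d r))         ≡⟨ cong (N *_) (∑-comm {N} {q} (λ r i → dist (rotate i (word d r)))) ⟩
        N * ∑[ i < q ] ∑[ r < N ] dist (rotate i (word d r))         ≡⟨ cong (N *_) (sum-cong-≗ {q} (λ i → sum-rotate d i dist)) ⟩
        N * ∑[ i < q ] A                                             ≡⟨ cong (N *_) (sum-const q A) ⟩
        N * (q * A)                                                  ≡⟨ sum-const N (q * A) ⟨
        ∑[ r < N ] (q * A)                                           ∎))
        where open ≡-Reasoning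
      x = word d (proj₁ average)
      t = total (proj₁ average)
      t-bound : t * t ≤ k * (q * q * d)
      -- Multiplied by `N³`, the left side is `(N t)² N`: the choice of `x` bounds the square, and
      -- density bounds the last factor by `k w`.
      t-bound = *-cancelʳ-≤ (t * t) (k * (q * q * d)) (N * (N * N)) (begin
        t * t * (N * (N * N))             ≡⟨ left t N ⟩
        (N * t) * (N * t) * N             ≤⟨ *-mono-≤ (*-mono-≤ (proj₂ average) (proj₂ average)) dense ⟩
        (q * A) * (q * A) * (k * w)       ≡⟨ middle q A k w ⟩
        k * (q * q) * (w * (A * A))       ≤⟨ *-monoʳ-≤ (k * (q * q)) (zero-set-bound d dist dist-lip W dist≡0) ⟩
        k * (q * q) * (d * (N * (N * N))) ≡⟨ right k q d N ⟩
        k * (q * q * d) * (N * (N * N))   ∎)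
        where
        open ≤-Reasoning
        left : ∀ t N → t * t * (N * (N * N)) ≡ (N * t) * (N * t) * N
        left = solve-∀
        middle : ∀ q A k w → (q * A) * (q * A) * (k * w) ≡ k * (q * q) * (w * (A * A))
        middle = solve-∀
        right : ∀ k q d N → k * (q * q) * (d * (N * (N * N))) ≡ k * (q * q * d) * (N * (N * N))
        right = solve-∀

  -- Graphs and subsets

  deleteVertex₀ : ∀ {n} → Graph (suc n) → Graph n
  deleteVertex₀ G = record
    { adj    = λ i j → adj G (suc i) (suc j)
    ; sym    = λ i j → Graph.sym G (suc i) (suc j)
    ; irrefl = λ i → irrefl G (suc i)
    }

  -- Induction by removing vertex zero, whose edges occur once in its row and once in its column,
  -- with nothing on the diagonal.
  handshake : ∀ {n} (G : Graph n) → 2 * edges G ≡ ∑[ i < n ] ∑[ j < n ] χ (adj G i j)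
  handshake {zero}  G = refl
  handshake {suc n} G = begin
    -- Comparison of indices with zero computes, so `edges G` unfolds to row zero plus the edges of
    -- the remaining graph.
    2 * (countB (λ j → adj G zero (suc j)) + edges (deleteVertex₀ G))
      ≡⟨ cong (λ z → 2 * (z + edges (deleteVertex₀ G))) (countB-sum (λ j → adj G zero (suc j))) ⟩
    2 * (row + edges (deleteVertex₀ G))
      ≡⟨ *-distribˡ-+ 2 row _ ⟩
    2 * row + 2 * edges (deleteVertex₀ G)
      ≡⟨ cong (2 * row +_) (handshake (deleteVertex₀ G)) ⟩
    row + (row + 0) + rest
      ≡⟨ cong (λ z → row + z + rest) (+-identityʳ row) ⟩
    row + row + rest
      ≡⟨ +-assoc row row rest ⟩
    row + (row + rest)
      ≡⟨ cong₂ (λ b z → χ b + row + (z + rest)) (irrefl G zero) (sum-cong-≗ (λ i → cong χ (Graph.sym G (suc i) zero))) ⟨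
    χ (adj G zero zero) + row + (∑[ i < n ] χ (adj G (suc i) zero) + rest)
      ≡⟨ cong (χ (adj G zero zero) + row +_) (sum-+ n (λ i → χ (adj G (suc i) zero)) (λ i → ∑[ j < n ] χ (adj G (suc i) (suc j)))) ⟨
    ∑[ i < suc n ] ∑[ j < suc n ] χ (adj G i j) ∎
    where
    open ≡-Reasoning
    row  = ∑[ j < n ] χ (adj G zero (suc j))
    rest = ∑[ i < n ] ∑[ j < n ] χ (adj G (suc i) (suc j))

  swap : ∀ a b c → a * (b * c) ≡ b * (a * c)
  swap a b c = trans (sym (*-assoc a b c)) (trans (cong (_* c) (*-comm a b)) (*-assoc b a c))

  2*nC2+n≡n² : ∀ n → 2 * (n C 2) + n ≡ n * n
  2*nC2+n≡n² zero    = refl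
  2*nC2+n≡n² (suc n) = begin
    2 * (suc n C 2) + suc n      ≡⟨ cong (λ z → 2 * z + suc n) (trans (sym (nCk+nC[k+1]≡[n+1]C[k+1] n 1)) (cong (_+ n C 2) (nC1≡n n))) ⟩
    2 * (n + n C 2) + suc n      ≡⟨ regroup n (n C 2) ⟩
    2 * (n C 2) + n + (n + suc n) ≡⟨ cong (_+ (n + suc n)) (2*nC2+n≡n² n) ⟩
    n * n + (n + suc n)          ≡⟨ square n ⟩
    suc n * suc n                ∎
    where
    open ≡-Reasoning
    regroup : ∀ n c → 2 * (n + c) + (1 + n) ≡ 2 * c + n + (n + (1 + n))
    regroup = solve-∀
    square : ∀ n → n * n + (n + (1 + n)) ≡ (1 + n) * (1 + n)
    square = solve-∀

  -- With ε = `s / K` these are the two bounds on the edge density, cleared of denominators. The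
  -- hypotheses on `e` carry an error of at most `q (1 + M)` per vertex; `K (1 + M) ≤ n - 1` and
  -- `s ≥ 1` keep `K` times the total error at most `s q n (n - 1)`, which is `2 s q` times `n C 2`.
  density-window : ∀ {p q s K M e n} .{{_ : NonZero s}} → p ≤ q → K * (1 + M) < n →
    2 * (q * e) ≤ n * (p * (n + M)) → n * (p * n) ≤ 2 * (q * e) + n * (q + p * M) →
    p * K * (n C 2) ≤ e * (q * K) + s * q * (n C 2) × e * (q * K) ≤ (p * K + s * q) * (n C 2)
  density-window {p} {q} {s} {K} {M} {e} {suc m} p≤q (s≤s large) upper lower = *-cancelˡ-≤ 2 below , *-cancelˡ-≤ 2 above
    where
    open ≤-Reasoning
    n = suc m
    2C≡nm : 2 * (n C 2) ≡ n * m
    2C≡nm = +-cancelʳ-≡ n (2 * (n C 2)) (n * m) (trans (2*nC2+n≡n² n) (trans (*-suc n m) (+-comm n (n * m))))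
    slack : q * (K * (1 + M)) ≤ s * q * m
    slack = begin
      q * (K * (1 + M))  ≤⟨ *-monoʳ-≤ q large ⟩
      q * m              ≤⟨ m≤n*m (q * m) s ⟩
      s * (q * m)        ≡⟨ *-assoc s q m ⟨
      s * q * m          ∎
    below : 2 * (p * K * (n C 2)) ≤ 2 * (e * (q * K) + s * q * (n C 2))
    below = begin
      2 * (p * K * (n C 2))                           ≡⟨ swap 2 (p * K) (n C 2) ⟩
      p * K * (2 * (n C 2))                           ≡⟨ cong (p * K *_) 2C≡nm ⟩
      p * K * (n * m)                                 ≤⟨ *-monoʳ-≤ (p * K) (*-monoʳ-≤ n (n≤1+n m)) ⟩
      p * K * (n * n)                                 ≡⟨ regroup₁ p K n ⟩
      K * (n * (p * n))                               ≤⟨ *-monoʳ-≤ K lower ⟩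
      K * (2 * (q * e) + n * (q + p * M))             ≤⟨ *-monoʳ-≤ K (+-monoʳ-≤ (2 * (q * e)) (*-monoʳ-≤ n (+-monoʳ-≤ q (*-monoˡ-≤ M p≤q)))) ⟩
      K * (2 * (q * e) + n * (q + q * M))             ≡⟨ regroup₂ K q e n M ⟩
      2 * (e * (q * K)) + n * (q * (K * (1 + M)))     ≤⟨ +-monoʳ-≤ (2 * (e * (q * K))) (*-monoʳ-≤ n slack) ⟩
      2 * (e * (q * K)) + n * (s * q * m)             ≡⟨ cong (2 * (e * (q * K)) +_) (trans (swap n (s * q) m) (cong (s * q *_) (sym 2C≡nm))) ⟩
      2 * (e * (q * K)) + s * q * (2 * (n C 2))       ≡⟨ cong (2 * (e * (q * K)) +_) (swap (s * q) 2 (n C 2)) ⟩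
      2 * (e * (q * K)) + 2 * (s * q * (n C 2))       ≡⟨ *-distribˡ-+ 2 (e * (q * K)) _ ⟨
      2 * (e * (q * K) + s * q * (n C 2))             ∎
      where
      regroup₁ : ∀ p K n → p * K * (n * n) ≡ K * (n * (p * n))
      regroup₁ = solve-∀
      regroup₂ : ∀ K q e n M → K * (2 * (q * e) + n * (q + q * M)) ≡ 2 * (e * (q * K)) + n * (q * (K * (1 + M)))
      regroup₂ = solve-∀
    above : 2 * (e * (q * K)) ≤ 2 * ((p * K + s * q) * (n C 2))
    above = begin
      2 * (e * (q * K))                               ≡⟨ regroup₁ e q K ⟩
      K * (2 * (q * e))                               ≤⟨ *-monoʳ-≤ K upper ⟩
      K * (n * (p * (n + M)))                         ≡⟨ regroup₂ K n p m M ⟩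
      n * (p * K * m + p * (K * (1 + M)))             ≤⟨ *-monoʳ-≤ n (+-monoʳ-≤ (p * K * m) (≤-trans (*-monoˡ-≤ (K * (1 + M)) p≤q) slack)) ⟩
      n * (p * K * m + s * q * m)                     ≡⟨ cong (n *_) (*-distribʳ-+ m (p * K) (s * q)) ⟨
      n * ((p * K + s * q) * m)                       ≡⟨ swap n (p * K + s * q) m ⟩
      (p * K + s * q) * (n * m)                       ≡⟨ cong ((p * K + s * q) *_) 2C≡nm ⟨
      (p * K + s * q) * (2 * (n C 2))                 ≡⟨ swap (p * K + s * q) 2 (n C 2) ⟩
      2 * ((p * K + s * q) * (n C 2))                 ∎
      where
      regroup₁ : ∀ e q K → 2 * (e * (q * K)) ≡ K * (2 * (q * e))
      regroup₁ = solve-∀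
      regroup₂′ : ∀ K n p m M → K * (n * (p * (m + (1 + M)))) ≡ n * (p * K * m + p * (K * (1 + M)))
      regroup₂′ = solve-∀
      regroup₂ : ∀ K n p m M → K * (n * (p * (1 + m + M))) ≡ n * (p * K * m + p * (K * (1 + M)))
      regroup₂ K n p m M = trans (cong (λ z → K * (n * (p * z))) (sym (+-suc m M))) (regroup₂′ K n p m M)

  ∣∣-sum : ∀ {n} (U : Subset n) → ∣ U ∣ ≡ ∑[ i < n ] χ (lookup U i)
  ∣∣-sum []          = refl
  ∣∣-sum (true  ∷ U) = cong suc (∣∣-sum U)
  ∣∣-sum (false ∷ U) = ∣∣-sum U

  sum-diagonal : ∀ {n} (i : Fin n) → ∑[ j < n ] χ ⌊ i ≟ j ⌋ ≡ 1
  sum-diagonal {suc n} zero    = cong suc (sum-replicate-zero n)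
  sum-diagonal {suc n} (suc i) = trans (sum-cong-≗ {n} suc-χ) (sum-diagonal i)
    where
    suc-χ : ∀ j → χ ⌊ suc i ≟ suc j ⌋ ≡ χ ⌊ i ≟ j ⌋
    suc-χ j with i ≟ j
    ... | yes _ = refl
    ... | no  _ = refl

  ≠ᵇ-sym : ∀ {n} (i j : Fin n) → i ≠ᵇ j ≡ j ≠ᵇ i
  ≠ᵇ-sym i j with i ≟ j | j ≟ i
  ... | yes _   | yes _   = refl
  ... | no  _   | no  _   = refl
  ... | yes i≡j | no j≢i  = contradiction (sym i≡j) j≢i
  ... | no i≢j  | yes j≡i = contradiction (sym j≡i) i≢j

  χ-≠ᵇ≡0 : ∀ {q} (a b : Fin q) → χ (a ≠ᵇ b) ≡ 0 → a ≡ b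
  χ-≠ᵇ≡0 a b eq with a ≟ b
  ... | yes a≡b = a≡b

  allB⇒ : ∀ {k} (f : Fin k → Bool) → allB f ≡ true → ∀ l → f l ≡ true
  allB⇒ {suc k} f all l with f zero in f0
  allB⇒ {suc k} f all zero    | true = f0
  allB⇒ {suc k} f all (suc l) | true = allB⇒ (f ∘ suc) all l

  ∧-trueʳ : ∀ {a b} → a ∧ b ≡ true → b ≡ true
  ∧-trueʳ {true} b≡true = b≡true

  -- The blow-up graph

  module Construction (p q d : ℕ) .{{q≢0 : NonZero q}} .{{d≢0 : NonZero d}} where

    N M : ℕ
    N = q ^ d
    M = d * N

    instance
      N≢0 : NonZero N
      N≢0 = m^n≢0 q d
      M≢0 : NonZero M
      M≢0 = m*n≢0 d N

    Cell : Set
    Cell = Fin d × Fin N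

    mix : Cell → Cell → Fin q
    mix (a , u) (b , v) = lookup (word d u) (a ⊕ b) ⊕ lookup (word d v) (a ⊕ b)

    mix-comm : ∀ x y → mix x y ≡ mix y x
    mix-comm (a , u) (b , v) rewrite ⊕-comm a b = ⊕-comm (lookup (word d u) (b ⊕ a)) _

    related : Cell → Cell → Bool
    related x y = toℕ (mix x y) <ᵇ p

    -- For fixed `b` the letter of `v` at `a ⊕ b` is uniform over the words `v`; translating it by
    -- the letter of `u` keeps it uniform, so a fraction `p / q` of the words qualify.
    sum-related : p ≤ q → ∀ x → q * ∑[ b < d ] ∑[ v < N ] χ (related x (b , v)) ≡ p * M
    sum-related p≤q (a , u) = begin
      q * ∑[ b < d ] ∑[ v < N ] χ (related (a , u) (b , v))    ≡⟨ *-distribˡ-sum q (λ b → ∑[ v < N ] χ (related (a , u) (b , v))) ⟩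
      ∑[ b < d ] (q * ∑[ v < N ] χ (related (a , u) (b , v)))  ≡⟨ sum-cong-≗ {d} column ⟩
      ∑[ b < d ] (N * p)                                       ≡⟨ sum-const d (N * p) ⟩
      d * (N * p)                                              ≡⟨ *-assoc d N p ⟨
      M * p                                                    ≡⟨ *-comm M p ⟩
      p * M                                                    ∎
      where
      open ≡-Reasoning
      column : ∀ b → q * ∑[ v < N ] χ (related (a , u) (b , v)) ≡ N * p
      column b = trans (sum-letter (a ⊕ b) (λ c → χ (toℕ (x ⊕ c) <ᵇ p)))
                       (cong (N *_) (trans (sum-⊕ (λ c → χ (toℕ c <ᵇ p)) x) (sum-<ᵇ p≤q)))
        where x = lookup (word d u) (a ⊕ b)

    module _ {n : ℕ} where

      -- Reducing modulo `M` puts `k` or `k + 1` vertices into every cell, where `k` is the floor of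
      -- `n / M`.
      cell : Fin n → Cell
      cell i = remQuot N (toℕ i mod M)

      blowup : Graph n
      blowup = record
        { adj    = λ i j → i ≠ᵇ j ∧ related (cell i) (cell j)
        ; sym    = λ i j → cong₂ _∧_ (≠ᵇ-sym i j) (cong (λ c → toℕ c <ᵇ p) (mix-comm (cell i) (cell j)))
        ; irrefl = λ i → cong (_∧ related (cell i) (cell i)) (≠ᵇ-irrefl i)
        }

      k : ℕ
      k = n / M

      kM≤n : k * M ≤ n
      kM≤n = m/n*n≤m n M

      n≤[1+k]M : n ≤ suc k * M
      n≤[1+k]M = ≤-trans (≤-reflexive (m≡m%n+[m/n]*n n M)) (+-monoˡ-≤ (k * M) (<⇒≤ (m%n<n n M)))

      module _ (G : Cell → ℕ) where

        private
          sum-cells : ∑[ s < M ] G (remQuot N s) ≡ ∑[ b < d ] ∑[ v < N ] G (b , v)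
          sum-cells = trans (sum-combine d N _) (sum-cong-≗ {d} (λ b → sum-cong-≗ {N} (λ v → cong G (remQuot-combine b v))))

        sum-cell-≤ : ∑[ i < n ] G (cell i) ≤ suc k * ∑[ b < d ] ∑[ v < N ] G (b , v)
        sum-cell-≤ = ≤-trans (sum-mod-≤ (G ∘ remQuot N) (suc k) n≤[1+k]M) (≤-reflexive (cong (suc k *_) sum-cells))

        sum-cell-≥ : k * ∑[ b < d ] ∑[ v < N ] G (b , v) ≤ ∑[ i < n ] G (cell i)
        sum-cell-≥ = ≤-trans (≤-reflexive (cong (k *_) (sym sum-cells))) (sum-mod-≥ (G ∘ remQuot N) k kM≤n)

      -- Degrees and edge count of the blow-up

      module _ (p≤q : p ≤ q) where

        private
          degree : Fin n → ℕ
          degree i = ∑[ j < n ] χ (adj blowup i j)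

          degree-≤ : ∀ i → q * degree i ≤ p * (n + M)
          degree-≤ i = begin
            q * degree i                                                       ≤⟨ *-monoʳ-≤ q (sum-mono (λ j → drop (i ≠ᵇ j) (related (cell i) (cell j)))) ⟩
            q * ∑[ j < n ] χ (related (cell i) (cell j))                       ≤⟨ *-monoʳ-≤ q (sum-cell-≤ (λ y → χ (related (cell i) y))) ⟩
            q * (suc k * ∑[ b < d ] ∑[ v < N ] χ (related (cell i) (b , v)))   ≡⟨ swap q (suc k) _ ⟩
            suc k * (q * ∑[ b < d ] ∑[ v < N ] χ (related (cell i) (b , v)))   ≡⟨ cong (suc k *_) (sum-related p≤q (cell i)) ⟩
            suc k * (p * M)                                                    ≡⟨ swap (suc k) p M ⟩
            p * (M + k * M)                                                    ≤⟨ *-monoʳ-≤ p (+-monoʳ-≤ M kM≤n) ⟩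
            p * (M + n)                                                        ≡⟨ cong (p *_) (+-comm M n) ⟩
            p * (n + M)                                                        ∎
            where
            open ≤-Reasoning
            drop : ∀ a b → χ (a ∧ b) ≤ χ b
            drop true  b = ≤-refl
            drop false b = z≤n

          -- There are two losses: the incomplete last block costs `p * M`, and the excluded loop at
          -- `i` costs `q`.
          degree-≥ : ∀ i → p * n ≤ q * degree i + (q + p * M)
          degree-≥ i = begin
            p * n                                                              ≤⟨ *-monoʳ-≤ p n≤[1+k]M ⟩
            p * (M + k * M)                                                    ≡⟨ distribute p M k ⟩
            k * (p * M) + p * M                                                ≡⟨ cong (λ z → k * z + p * M) (sum-related p≤q (cell i)) ⟨
            k * (q * ∑[ b < d ] ∑[ v < N ] χ (related (cell i) (b , v))) + p * M ≡⟨ cong (_+ p * M) (swap k q _) ⟩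
            q * (k * ∑[ b < d ] ∑[ v < N ] χ (related (cell i) (b , v))) + p * M ≤⟨ +-monoˡ-≤ (p * M) (*-monoʳ-≤ q (sum-cell-≥ (λ y → χ (related (cell i) y)))) ⟩
            q * ∑[ j < n ] χ (related (cell i) (cell j)) + p * M               ≤⟨ +-monoˡ-≤ (p * M) (*-monoʳ-≤ q (sum-mono (λ j → split ⌊ i ≟ j ⌋ (related (cell i) (cell j))))) ⟩
            q * ∑[ j < n ] (χ (adj blowup i j) + χ ⌊ i ≟ j ⌋) + p * M          ≡⟨ cong (λ z → q * z + p * M) (trans (sum-+ n (λ j → χ (adj blowup i j)) _) (cong (degree i +_) (sum-diagonal i))) ⟩
            q * (degree i + 1) + p * M                                         ≡⟨ collect q (degree i) (p * M) ⟩
            q * degree i + (q + p * M)                                         ∎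
            where
            open ≤-Reasoning
            distribute : ∀ p M k → p * (M + k * M) ≡ k * (p * M) + p * M
            distribute = solve-∀
            collect : ∀ q x y → q * (x + 1) + y ≡ q * x + (q + y)
            collect = solve-∀
            split : ∀ a b → χ b ≤ χ (not a ∧ b) + χ a
            split false b = m≤m+n (χ b) 0
            split true  b = χ≤1 b

          total : 2 * (q * edges blowup) ≡ ∑[ i < n ] (q * degree i)
          total = trans (swap 2 q (edges blowup)) (trans (cong (q *_) (handshake blowup)) (*-distribˡ-sum q degree))

        edges-≤ : 2 * (q * edges blowup) ≤ n * (p * (n + M))
        edges-≤ = ≤-trans (≤-reflexive total) (≤-trans (sum-mono degree-≤) (≤-reflexive (sum-const n (p * (n + M)))))

        edges-≥ : n * (p * n) ≤ 2 * (q * edges blowup) + n * (q + p * M)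
        edges-≥ = begin
          n * (p * n)                                    ≡⟨ sum-const n (p * n) ⟨
          ∑[ i < n ] (p * n)                             ≤⟨ sum-mono degree-≥ ⟩
          ∑[ i < n ] (q * degree i + (q + p * M))        ≡⟨ sum-+const n (q + p * M) (λ i → q * degree i) ⟩
          ∑[ i < n ] (q * degree i) + n * (q + p * M)    ≡⟨ cong (_+ n * (q + p * M)) total ⟨
          2 * (q * edges blowup) + n * (q + p * M)       ∎
          where open ≤-Reasoning

      -- For `n ≥ M`, rounding up to whole blocks at most doubles the number of vertices; this is
      -- where the factor 2 in front of `K` comes from below.
      [1+k]M≤2n : M ≤ n → suc k * M ≤ 2 * n
      [1+k]M≤2n M≤n = ≤-trans (+-mono-≤ M≤n kM≤n) (≤-reflexive (cong (n +_) (sym (+-identityʳ n))))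

      -- Vertices near a rotation orbit and their common neighbours

      module _ (a : Fin d) (x : Vec (Fin q) d) (u : Fin q → Fin N)
               (f : Fin q → Fin n) (cell-f : ∀ i → cell (f i) ≡ (a , u i)) where

        private
          mistake : Fin d → Fin q → ℕ
          mistake j i = χ (lookup (rotate i x) j ≠ᵇ lookup (word d (u i)) j)

          -- Nonzero exactly at the exceptional coordinates, where some word fails to match its
          -- rotation of `x`. The sum over coordinates is `t`, so at most `t` coordinates are
          -- exceptional.
          mistakes : Fin d → ℕ
          mistakes j = sum (mistake j)

          t : ℕ
          t = ∑[ i < q ] hamming (rotate i x) (word d (u i))

          sum-mistakes : sum mistakes ≡ t
          sum-mistakes = ∑-comm mistake

          faithful : ∀ j → mistakes j ≡ 0 → ∀ i → lookup (word d (u i)) j ≡ i ⊕ lookup x j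
          faithful j none i = trans (sym (χ-≠ᵇ≡0 _ _ no-mistake)) (lookup-map j (i ⊕_) x)
            where
            no-mistake : mistake j i ≡ 0
            no-mistake = n≤0⇒n≡0 (≤-trans (term≤sum (mistake j) i) (≤-reflexive none))

        -- Two distinct indices sharing a vertex would share a word, although at a coordinate
        -- without mistakes the letters `i ⊕ lookup x j` and `i′ ⊕ lookup x j` differ. Every
        -- coordinate would then carry a mistake, forcing `d ≤ t`.
        near-orbit-injective : t < d → Injective _≡_ _≡_ f
        near-orbit-injective t<d {i} {i′} fi≡fi′ with i ≟ i′
        ... | yes i≡i′ = i≡i′
        ... | no  i≢i′ = contradiction t<d (≤⇒≯ d≤t)
          where
          ui≡ui′ : u i ≡ u i′
          ui≡ui′ = ,-injectiveʳ (trans (sym (cell-f i)) (trans (cong cell fi≡fi′) (cell-f i′)))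
          mistaken : ∀ j → 1 ≤ mistakes j
          mistaken j = n≢0⇒n>0 (λ none → i≢i′ (⊕-cancelʳ (lookup x j)
            (trans (sym (faithful j none i)) (trans (cong (λ v → lookup (word d v) j) ui≡ui′) (faithful j none i′)))))
          d≤t : d ≤ t
          d≤t = begin
            d              ≡⟨ *-identityʳ d ⟨
            d * 1          ≡⟨ sum-const d 1 ⟨
            ∑[ j < d ] 1   ≤⟨ sum-mono mistaken ⟩
            sum mistakes   ≡⟨ sum-mistakes ⟩
            t              ∎
            where open ≤-Reasoning

        module _ (g : Fin (suc p) → Fin q) (g-injective : Injective _≡_ _≡_ g) where

          private
            common : Fin n → Bool
            common y = allB (λ l → adj blowup (f (g l)) y)

            related-all : ∀ y → common y ≡ true → ∀ l → related (a , u (g l)) (cell y) ≡ true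
            related-all y all l = subst (λ z → related z (cell y) ≡ true) (cell-f (g l)) (∧-trueʳ {f (g l) ≠ᵇ y} (allB⇒ (λ l → adj blowup (f (g l)) y) all l))

            -- At a coordinate without mistakes the p + 1 values of mix are distinct, so they cannot all be below p.
            mistaken : ∀ b v → (∀ l → related (a , u (g l)) (b , v) ≡ true) → 1 ≤ mistakes (a ⊕ b)
            mistaken b v all = n≢0⇒n>0 (λ none → 1+n≰n (injective⇒≤ {f = value none} (value-injective none)))
              where
              j = a ⊕ b
              c = lookup (word d v) j
              below : mistakes j ≡ 0 → ∀ l → toℕ (g l ⊕ lookup x j ⊕ c) < p
              below none l = <ᵇ⇒< _ p (Equivalence.from Bool.T-≡
                (subst (λ z → (toℕ (z ⊕ c) <ᵇ p) ≡ true) (faithful j none (g l)) (all l)))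
              value : mistakes j ≡ 0 → Fin (suc p) → Fin p
              value none l = fromℕ< (below none l)
              value-injective : ∀ none → Injective _≡_ _≡_ (value none)
              value-injective none {l} {l′} eq = g-injective (⊕-cancelʳ (lookup x j) (⊕-cancelʳ c
                (toℕ-injective (fromℕ<-injective _ _ (below none l) (below none l′) eq))))

            common≤mistakes : ∀ y → χ (common y) ≤ mistakes (a ⊕ proj₁ (cell y))
            common≤mistakes y = bound (common y) refl
              where
              bound : ∀ b → common y ≡ b → χ b ≤ mistakes (a ⊕ proj₁ (cell y))
              bound false _   = z≤n
              bound true  all = mistaken _ (proj₂ (cell y)) (related-all y all)

          -- A common neighbour in the cell `(b , v)` forces a mistake at `a ⊕ b`. Translation by
          -- `a` permutes the coordinates, so summing the mistakes over all cells gives `N * t`, and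
          -- each cell holds at most `k + 1` vertices.
          commonNbrs-≤ : commonNbrs blowup (λ l → f (g l)) ≤ suc k * (N * t)
          commonNbrs-≤ = begin
            commonNbrs blowup (λ l → f (g l))                    ≡⟨ countB-sum common ⟩
            ∑[ y < n ] χ (common y)                              ≤⟨ sum-mono common≤mistakes ⟩
            ∑[ y < n ] mistakes (a ⊕ proj₁ (cell y))             ≤⟨ sum-cell-≤ (λ y → mistakes (a ⊕ proj₁ y)) ⟩
            suc k * ∑[ b < d ] ∑[ v < N ] mistakes (a ⊕ b)       ≡⟨ cong (suc k *_) (sum-cong-≗ {d} (λ b → sum-const N (mistakes (a ⊕ b)))) ⟩
            suc k * ∑[ b < d ] (N * mistakes (a ⊕ b))            ≡⟨ cong (suc k *_) (*-distribˡ-sum N (λ b → mistakes (a ⊕ b))) ⟨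
            suc k * (N * ∑[ b < d ] mistakes (a ⊕ b))            ≡⟨ cong (λ z → suc k * (N * z)) (trans (sum-⊕ mistakes a) sum-mistakes) ⟩
            suc k * (N * t)                                      ∎
            where open ≤-Reasoning

      -- From dense vertex sets to dense sets of words

      module _ (U : Subset n) where

        private
          meets? : ∀ y → Dec (∃ λ i → lookup U i ≡ true × cell i ≡ y)
          meets? y = any? (λ i → (lookup U i Bool.≟ true) ×-dec (≡-dec _≟_ _≟_ (cell i) y))

        trace : Cell → Bool
        trace y = ⌊ meets? y ⌋

        trace-preimage : ∀ y → trace y ≡ true → ∃ λ i → lookup U i ≡ true × cell i ≡ y
        trace-preimage y hit with meets? y
        ... | yes found = found

        trace-cell : ∀ i → χ (lookup U i) ≤ χ (trace (cell i))
        trace-cell i with lookup U i in Ui | meets? (cell i)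
        ... | false | _       = z≤n
        ... | true  | yes _   = ≤-refl
        ... | true  | no none = contradiction (i , Ui , refl) none

        -- Each cell holds at most `k + 1` vertices, so a set `U` of density `1 / K` meets at least
        -- a fraction `1 / (2 K)` of the cells. The outer sum runs over offsets, ready for choosing
        -- one of them by averaging.
        trace-dense : ∀ K → M ≤ n → n ≤ K * ∣ U ∣ → d * N ≤ ∑[ a < d ] (2 * K * ∑[ v < N ] χ (trace (a , v)))
        trace-dense K M≤n dense = *-cancelˡ-≤ n {{>-nonZero (≤-trans (>-nonZero⁻¹ M) M≤n)}} (begin
          n * M                                    ≤⟨ *-monoˡ-≤ M dense ⟩
          K * ∣ U ∣ * M                            ≡⟨ cong (λ z → K * z * M) (∣∣-sum U) ⟩
          K * ∑[ i < n ] χ (lookup U i) * M        ≤⟨ *-monoˡ-≤ M (*-monoʳ-≤ K (≤-trans (sum-mono trace-cell) (sum-cell-≤ (χ ∘ trace)))) ⟩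
          K * (suc k * w) * M                      ≡⟨ regroup K (suc k) w M ⟩
          K * w * (suc k * M)                      ≤⟨ *-monoʳ-≤ (K * w) ([1+k]M≤2n M≤n) ⟩
          K * w * (2 * n)                          ≡⟨ regroup′ K w n ⟩
          n * (2 * K * w)                          ≡⟨ cong (n *_) (*-distribˡ-sum (2 * K) (λ a → ∑[ v < N ] χ (trace (a , v)))) ⟩
          n * ∑[ a < d ] (2 * K * ∑[ v < N ] χ (trace (a , v))) ∎)
          where
          open ≤-Reasoning
          w = ∑[ a < d ] ∑[ v < N ] χ (trace (a , v))
          regroup : ∀ K k w M → K * (k * w) * M ≡ K * w * (k * M)
          regroup = solve-∀
          regroup′ : ∀ K w n → K * w * (2 * n) ≡ n * (2 * K * w)
          regroup′ = solve-∀

      module _ (K : ℕ) .{{_ : NonZero K}} (large : 8 * (K * K * K) * (q * q) < d) (M≤n : M ≤ n) (U : Subset n) where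

        private
          Spread : Set
          Spread = Σ (Fin q → Fin n) λ f → Injective _≡_ _≡_ f × (∀ i → f i ∈ U) ×
            (∀ (g : Fin (suc p) → Fin q) → Injective _≡_ _≡_ g → K * commonNbrs blowup (λ l → f (g l)) < n)

        -- The inequality `2 K t < d` serves twice: it gives `t < d`, hence distinct vertices, and
        -- it pushes the bound `(k + 1) N t ≤ 2 n t / d` on common neighbours below `n / K`.
        near-orbit⇒spread : ∀ a x u → (∀ i → trace U (a , u i) ≡ true) →
          (let t = ∑[ i < q ] hamming (rotate i x) (word d (u i)) in t * t ≤ 2 * K * (q * q * d)) → Spread
        near-orbit⇒spread a x u hit t²≤ =
          f , near-orbit-injective a x u f cell-f (≤-<-trans (m≤n*m t (2 * K) {{m*n≢0 2 K}}) 2Kt<d)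
            , (λ i → lookup⇒[]= (f i) U (proj₁ (proj₂ (trace-preimage U (a , u i) (hit i)))))
            , few-common
          where
          t : ℕ
          t = ∑[ i < q ] hamming (rotate i x) (word d (u i))

          f : Fin q → Fin n
          f i = proj₁ (trace-preimage U (a , u i) (hit i))

          cell-f : ∀ i → cell (f i) ≡ (a , u i)
          cell-f i = proj₂ (proj₂ (trace-preimage U (a , u i) (hit i)))

          2Kt<d : 2 * K * t < d
          -- By squaring: `(2 K t)² ≤ 8 K³ q² d < d²`, which explains the lower bound imposed on
          -- `d`.
          2Kt<d = ≰⇒> (λ d≤2Kt → <⇒≱ large (*-cancelʳ-≤ d _ d (begin
            d * d                               ≤⟨ *-mono-≤ d≤2Kt d≤2Kt ⟩
            2 * K * t * (2 * K * t)             ≡⟨ regroup K t ⟩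
            4 * (K * K) * (t * t)               ≤⟨ *-monoʳ-≤ (4 * (K * K)) t²≤ ⟩
            4 * (K * K) * (2 * K * (q * q * d)) ≡⟨ regroup′ K q d ⟩
            8 * (K * K * K) * (q * q) * d       ∎)))
            where
            open ≤-Reasoning
            regroup : ∀ K t → 2 * K * t * (2 * K * t) ≡ 4 * (K * K) * (t * t)
            regroup = solve-∀
            regroup′ : ∀ K q d → 4 * (K * K) * (2 * K * (q * q * d)) ≡ 8 * (K * K * K) * (q * q) * d
            regroup′ = solve-∀

          few-common : ∀ (g : Fin (suc p) → Fin q) → Injective _≡_ _≡_ g → K * commonNbrs blowup (λ l → f (g l)) < n
          few-common g g-injective = *-cancelˡ-< d _ _ (begin-strict
            d * (K * commonNbrs blowup (λ l → f (g l)))  ≤⟨ *-monoʳ-≤ d (*-monoʳ-≤ K (commonNbrs-≤ a x u f cell-f g g-injective)) ⟩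
            d * (K * (suc k * (N * t)))                  ≡⟨ regroup d K (suc k) N t ⟩
            K * t * (suc k * M)                          ≤⟨ *-monoʳ-≤ (K * t) ([1+k]M≤2n M≤n) ⟩
            K * t * (2 * n)                              ≡⟨ regroup′ K t n ⟩
            2 * K * t * n                                <⟨ *-monoˡ-< n {{>-nonZero (≤-trans (>-nonZero⁻¹ M) M≤n)}} 2Kt<d ⟩
            d * n                                        ∎)
            where
            open ≤-Reasoning
            regroup : ∀ d K k N t → d * (K * (k * (N * t))) ≡ K * t * (k * (d * N))
            regroup = solve-∀
            regroup′ : ∀ K t n → K * t * (2 * n) ≡ 2 * K * t * n
            regroup′ = solve-∀

        -- The `q` vertices share one offset `a`, so that against a cell `(b , v)` all their words
        -- are read at the same coordinate `a ⊕ b`. Averaging finds an offset whose slice of the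
        -- trace has density at least `1 / (2 K)`.
        spread-subset : n ≤ K * ∣ U ∣ → Spread
        spread-subset dense =
          let a , slice-dense = sum-≤⇒∃≤ {d} (λ _ → N) (λ a → 2 * K * ∑[ v < N ] χ (trace U (a , v)))
                (≤-trans (≤-reflexive (sum-const d N)) (trace-dense U K M≤n dense))
              x , u , hit , t²≤ = dense⇒near-orbit d (2 * K) (λ v → trace U (a , v)) slice-dense
          in near-orbit⇒spread a x u hit t²≤

-- Rational inequalities reduced to natural numbers

module Rational where

  open import Defs hiding (sym)
  open import Data.Integer using (+_)
  import Data.Integer as ℤ
  import Data.Integer.Properties as ℤₚ
  open import Data.Nat using (ℕ; zero; suc; NonZero)
  import Data.Nat as ℕ
  import Data.Nat.Properties as ℕₚ
  open import Data.Rational using (ℚ; _/_; _+_; _-_; -_; _*_; _≤_; _<_; Positive; NonNegative; toℚᵘ; fromℚᵘ; nonNegative; positive)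
  open import Data.Rational.Properties
  open import Data.Rational.Solver using (module +-*-Solver)
  open import Data.Rational.Unnormalised as ℚᵘ using (mkℚᵘ; *≡*; *≤*; *<*)
  import Data.Rational.Unnormalised.Properties as ℚᵘₚ
  open import Relation.Binary.PropositionalEquality using (_≡_; refl; sym; trans; cong; cong₂; subst₂; module ≡-Reasoning)

  fromℚᵘ-homo-+ : ∀ x y → fromℚᵘ (x ℚᵘ.+ y) ≡ fromℚᵘ x + fromℚᵘ y
  fromℚᵘ-homo-+ x y = toℚᵘ-injective (begin
    toℚᵘ (fromℚᵘ (x ℚᵘ.+ y))                     ≈⟨ toℚᵘ-fromℚᵘ (x ℚᵘ.+ y) ⟩
    x ℚᵘ.+ y                                     ≈⟨ ℚᵘₚ.+-cong (toℚᵘ-fromℚᵘ x) (toℚᵘ-fromℚᵘ y) ⟨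
    toℚᵘ (fromℚᵘ x) ℚᵘ.+ toℚᵘ (fromℚᵘ y)         ≈⟨ toℚᵘ-homo-+ (fromℚᵘ x) (fromℚᵘ y) ⟨
    toℚᵘ (fromℚᵘ x + fromℚᵘ y)                   ∎)
    where open import Relation.Binary.Reasoning.Setoid ℚᵘₚ.≃-setoid

  fromℚᵘ-homo-* : ∀ x y → fromℚᵘ (x ℚᵘ.* y) ≡ fromℚᵘ x * fromℚᵘ y
  fromℚᵘ-homo-* x y = toℚᵘ-injective (begin
    toℚᵘ (fromℚᵘ (x ℚᵘ.* y))                     ≈⟨ toℚᵘ-fromℚᵘ (x ℚᵘ.* y) ⟩
    x ℚᵘ.* y                                     ≈⟨ ℚᵘₚ.*-cong (toℚᵘ-fromℚᵘ x) (toℚᵘ-fromℚᵘ y) ⟨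
    toℚᵘ (fromℚᵘ x) ℚᵘ.* toℚᵘ (fromℚᵘ y)         ≈⟨ toℚᵘ-homo-* (fromℚᵘ x) (fromℚᵘ y) ⟨
    toℚᵘ (fromℚᵘ x * fromℚᵘ y)                   ∎)
    where open import Relation.Binary.Reasoning.Setoid ℚᵘₚ.≃-setoid

  -- `ℕ→ℚ m` and `fromℚᵘ (mkℚᵘ (+ m) 0)` agree by computation, so identities between unnormalised
  -- fractions transfer.
  ℕ→ℚ-+ : ∀ m n → ℕ→ℚ (m ℕ.+ n) ≡ ℕ→ℚ m + ℕ→ℚ n
  ℕ→ℚ-+ m n = trans (fromℚᵘ-cong {mkℚᵘ (+ (m ℕ.+ n)) 0} {mkℚᵘ (+ m) 0 ℚᵘ.+ mkℚᵘ (+ n) 0} (*≡* (cong (ℤ._* (+ 1)) (sym (cong₂ ℤ._+_ (ℤₚ.*-identityʳ (+ m)) (ℤₚ.*-identityʳ (+ n)))))))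
    (fromℚᵘ-homo-+ (mkℚᵘ (+ m) 0) (mkℚᵘ (+ n) 0))

  ℕ→ℚ-* : ∀ m n → ℕ→ℚ (m ℕ.* n) ≡ ℕ→ℚ m * ℕ→ℚ n
  ℕ→ℚ-* m n = trans (fromℚᵘ-cong {mkℚᵘ (+ (m ℕ.* n)) 0} {mkℚᵘ (+ m) 0 ℚᵘ.* mkℚᵘ (+ n) 0} (*≡* (cong (ℤ._* (+ 1)) (ℤₚ.pos-* m n))))
    (fromℚᵘ-homo-* (mkℚᵘ (+ m) 0) (mkℚᵘ (+ n) 0))

  /-*-cancel : ∀ p q .{{_ : NonZero q}} → + p / q * ℕ→ℚ q ≡ ℕ→ℚ p
  /-*-cancel p (suc q) = trans (sym (fromℚᵘ-homo-* (mkℚᵘ (+ p) q) (mkℚᵘ (+ suc q) 0)))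
    (fromℚᵘ-cong {mkℚᵘ (+ p) q ℚᵘ.* mkℚᵘ (+ suc q) 0} {mkℚᵘ (+ p) 0} (*≡* (trans (ℤₚ.*-identityʳ _) (cong (λ z → + p ℤ.* (+ z)) (sym (ℕₚ.*-identityʳ (suc q)))))))

  ℕ→ℚ-mono-≤ : ∀ {m n} → m ℕ.≤ n → ℕ→ℚ m ≤ ℕ→ℚ n
  ℕ→ℚ-mono-≤ {m} {n} m≤n = toℚᵘ-cancel-≤ (ℚᵘₚ.≤-respˡ-≃ (ℚᵘₚ.≃-sym (toℚᵘ-fromℚᵘ (mkℚᵘ (+ m) 0)))
    (ℚᵘₚ.≤-respʳ-≃ (ℚᵘₚ.≃-sym (toℚᵘ-fromℚᵘ (mkℚᵘ (+ n) 0)))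
      (*≤* (ℤₚ.*-monoʳ-≤-nonNeg (+ 1) (ℤ.+≤+ m≤n)))))

  ℕ→ℚ-mono-< : ∀ {m n} → m ℕ.< n → ℕ→ℚ m < ℕ→ℚ n
  ℕ→ℚ-mono-< {m} {n} m<n = toℚᵘ-cancel-< (ℚᵘₚ.<-respˡ-≃ (ℚᵘₚ.≃-sym (toℚᵘ-fromℚᵘ (mkℚᵘ (+ m) 0)))
    (ℚᵘₚ.<-respʳ-≃ (ℚᵘₚ.≃-sym (toℚᵘ-fromℚᵘ (mkℚᵘ (+ n) 0)))
      (*<* (ℤₚ.*-monoʳ-<-pos (+ 1) (ℤ.+<+ m<n)))))

  ℕ→ℚ-cancel-≤ : ∀ {m n} → ℕ→ℚ m ≤ ℕ→ℚ n → m ℕ.≤ n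
  ℕ→ℚ-cancel-≤ {m} {n} m≤n = ℕₚ.≮⇒≥ (λ n<m → <-irrefl refl (<-≤-trans (ℕ→ℚ-mono-< n<m) m≤n))

  ℕ→ℚ-positive : ∀ n .{{_ : NonZero n}} → Positive (ℕ→ℚ n)
  ℕ→ℚ-positive (suc n) = positive (ℕ→ℚ-mono-< {0} {suc n} (ℕ.s≤s ℕ.z≤n))

  ℕ→ℚ-nonNegative : ∀ n → NonNegative (ℕ→ℚ n)
  ℕ→ℚ-nonNegative n = nonNegative (ℕ→ℚ-mono-≤ {0} {n} ℕ.z≤n)

  exchange : ∀ x n k → x * n * k ≡ x * k * n
  exchange = solve 3 (λ x n k → x :* n :* k := x :* k :* n) refl
    where open +-*-Solver

  module _ {x : ℚ} {k s : ℕ} .{{_ : NonZero k}} (x*k≡s : x * ℕ→ℚ k ≡ ℕ→ℚ s) where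

    private
      -- The equation `x * ℕ→ℚ k ≡ ℕ→ℚ s` encodes `x = s / k` without a division; multiplying by `k`
      -- turns `x * n` into a natural number.
      clear : ∀ n → x * ℕ→ℚ n * ℕ→ℚ k ≡ ℕ→ℚ (s ℕ.* n)
      clear n = trans (exchange x (ℕ→ℚ n) (ℕ→ℚ k)) (trans (cong (_* ℕ→ℚ n) x*k≡s) (sym (ℕ→ℚ-* s n)))

    fraction-*-≤ : ∀ {m n} → x * ℕ→ℚ n ≤ ℕ→ℚ m → s ℕ.* n ℕ.≤ m ℕ.* k
    fraction-*-≤ {m} {n} xn≤m = ℕ→ℚ-cancel-≤ (subst₂ _≤_ (clear n) (sym (ℕ→ℚ-* m k))
      (*-monoʳ-≤-nonNeg (ℕ→ℚ k) {{ℕ→ℚ-nonNegative k}} xn≤m))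

    ≤-fraction-* : ∀ {m n} → m ℕ.* k ℕ.≤ s ℕ.* n → ℕ→ℚ m ≤ x * ℕ→ℚ n
    ≤-fraction-* {m} {n} mk≤sn = *-cancelʳ-≤-pos (ℕ→ℚ k) {{ℕ→ℚ-positive k}}
      (subst₂ _≤_ (ℕ→ℚ-* m k) (sym (clear n)) (ℕ→ℚ-mono-≤ mk≤sn))

    <-fraction-* : ∀ {m n} → m ℕ.* k ℕ.< s ℕ.* n → ℕ→ℚ m < x * ℕ→ℚ n
    <-fraction-* {m} {n} mk<sn = *-cancelʳ-<-nonNeg (ℕ→ℚ k) {{ℕ→ℚ-nonNegative k}}
      (subst₂ _<_ (ℕ→ℚ-* m k) (sym (clear n)) (ℕ→ℚ-mono-< mk<sn))

  module _ {x y : ℚ} {k l s r : ℕ} .{{k≢0 : NonZero k}} .{{l≢0 : NonZero l}}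
           (x*k≡s : x * ℕ→ℚ k ≡ ℕ→ℚ s) (y*l≡r : y * ℕ→ℚ l ≡ ℕ→ℚ r) where

    private
      instance
        kl≢0 : NonZero (k ℕ.* l)
        kl≢0 = ℕₚ.m*n≢0 k l

      common-denominator : (x + y) * ℕ→ℚ (k ℕ.* l) ≡ ℕ→ℚ (s ℕ.* l ℕ.+ r ℕ.* k)
      common-denominator = begin
        (x + y) * ℕ→ℚ (k ℕ.* l)                          ≡⟨ cong ((x + y) *_) (ℕ→ℚ-* k l) ⟩
        (x + y) * (ℕ→ℚ k * ℕ→ℚ l)                        ≡⟨ expand x y (ℕ→ℚ k) (ℕ→ℚ l) ⟩
        x * ℕ→ℚ k * ℕ→ℚ l + y * ℕ→ℚ l * ℕ→ℚ k            ≡⟨ cong₂ (λ a b → a * ℕ→ℚ l + b * ℕ→ℚ k) x*k≡s y*l≡r ⟩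
        ℕ→ℚ s * ℕ→ℚ l + ℕ→ℚ r * ℕ→ℚ k                    ≡⟨ cong₂ _+_ (ℕ→ℚ-* s l) (ℕ→ℚ-* r k) ⟨
        ℕ→ℚ (s ℕ.* l) + ℕ→ℚ (r ℕ.* k)                    ≡⟨ ℕ→ℚ-+ (s ℕ.* l) (r ℕ.* k) ⟨
        ℕ→ℚ (s ℕ.* l ℕ.+ r ℕ.* k)                        ∎
        where
        open ≡-Reasoning
        expand : ∀ x y k l → (x + y) * (k * l) ≡ x * k * l + y * l * k
        expand = solve 4 (λ x y k l → (x :+ y) :* (k :* l) := x :* k :* l :+ y :* l :* k) refl
          where open +-*-Solver

    ≤-sum-fractions-* : ∀ {m n} → m ℕ.* (k ℕ.* l) ℕ.≤ (s ℕ.* l ℕ.+ r ℕ.* k) ℕ.* n → ℕ→ℚ m ≤ (x + y) * ℕ→ℚ n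
    ≤-sum-fractions-* {m} {n} = ≤-fraction-* {x + y} {k ℕ.* l} {s ℕ.* l ℕ.+ r ℕ.* k} common-denominator {m} {n}

    -- Truncated subtraction is avoided: the negative term `y * n` stands on the larger side of the
    -- hypothesis in ℕ and is cancelled only in ℚ.
    difference-fractions-*-≤ : ∀ {m n} → s ℕ.* l ℕ.* n ℕ.≤ m ℕ.* (k ℕ.* l) ℕ.+ r ℕ.* k ℕ.* n → (x - y) * ℕ→ℚ n ≤ ℕ→ℚ m
    difference-fractions-*-≤ {m} {n} bound = *-cancelʳ-≤-pos (ℕ→ℚ (k ℕ.* l)) {{ℕ→ℚ-positive (k ℕ.* l)}} (begin
      (x - y) * ℕ→ℚ n * ℕ→ℚ (k ℕ.* l)                              ≡⟨ cong ((x - y) * ℕ→ℚ n *_) (ℕ→ℚ-* k l) ⟩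
      (x - y) * ℕ→ℚ n * (ℕ→ℚ k * ℕ→ℚ l)                            ≡⟨ expand x y (ℕ→ℚ n) (ℕ→ℚ k) (ℕ→ℚ l) ⟩
      x * ℕ→ℚ k * ℕ→ℚ l * ℕ→ℚ n - y * ℕ→ℚ l * ℕ→ℚ k * ℕ→ℚ n        ≡⟨ cong₂ (λ a b → a * ℕ→ℚ l * ℕ→ℚ n - b * ℕ→ℚ k * ℕ→ℚ n) x*k≡s y*l≡r ⟩
      ℕ→ℚ s * ℕ→ℚ l * ℕ→ℚ n - ℕ→ℚ r * ℕ→ℚ k * ℕ→ℚ n                ≡⟨ cong₂ _-_ (triple s l n) (triple r k n) ⟨
      ℕ→ℚ (s ℕ.* l ℕ.* n) - ℕ→ℚ (r ℕ.* k ℕ.* n)                    ≤⟨ +-monoˡ-≤ (- ℕ→ℚ (r ℕ.* k ℕ.* n)) (ℕ→ℚ-mono-≤ bound) ⟩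
      ℕ→ℚ (m ℕ.* (k ℕ.* l) ℕ.+ r ℕ.* k ℕ.* n) - ℕ→ℚ (r ℕ.* k ℕ.* n) ≡⟨ cong (_- ℕ→ℚ (r ℕ.* k ℕ.* n)) (ℕ→ℚ-+ (m ℕ.* (k ℕ.* l)) (r ℕ.* k ℕ.* n)) ⟩
      ℕ→ℚ (m ℕ.* (k ℕ.* l)) + ℕ→ℚ (r ℕ.* k ℕ.* n) - ℕ→ℚ (r ℕ.* k ℕ.* n) ≡⟨ cancel (ℕ→ℚ (m ℕ.* (k ℕ.* l))) (ℕ→ℚ (r ℕ.* k ℕ.* n)) ⟩
      ℕ→ℚ (m ℕ.* (k ℕ.* l))                                        ≡⟨ ℕ→ℚ-* m (k ℕ.* l) ⟩
      ℕ→ℚ m * ℕ→ℚ (k ℕ.* l)                                        ∎)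
      where
      open ≤-Reasoning
      triple : ∀ a b c → ℕ→ℚ (a ℕ.* b ℕ.* c) ≡ ℕ→ℚ a * ℕ→ℚ b * ℕ→ℚ c
      triple a b c = trans (ℕ→ℚ-* (a ℕ.* b) c) (cong (_* ℕ→ℚ c) (ℕ→ℚ-* a b))
      expand : ∀ x y n k l → (x - y) * n * (k * l) ≡ x * k * l * n - y * l * k * n
      expand = solve 5 (λ x y n k l → (x :- y) :* n :* (k :* l) := x :* k :* l :* n :- y :* l :* k :* n) refl
        where open +-*-Solver
      cancel : ∀ a b → a + b - b ≡ a
      cancel = solve 2 (λ a b → a :+ b :- b := a) refl
        where open +-*-Solver

-- Passage from `1 / K` to ε and choice of parameters

open import Defs
open import Data.Nat using (ℕ; suc; _≥_; NonZero) renaming (_<_ to _<ℕ_; _≤_ to _≤ℕ_)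
open import Data.Fin using (Fin)
open import Data.Nat.Combinatorics using (_C_)
open import Data.Fin.Subset using (Subset; _∈_; ∣_∣)
open import Data.Integer using (+_; +[1+_])
open import Data.Rational using (ℚ; mkℚ; _/_; _+_; _-_; _*_; _≤_; _<_; Positive)
open import Data.Rational.Properties using (↥p/↧p≡p)
open import Data.Product using (Σ; _×_; _,_; proj₁; proj₂)
open import Function.Definitions using (Injective)
open import Relation.Binary.PropositionalEquality using (_≡_; trans; cong) renaming (sym to ≡-sym)
import Data.Nat as ℕ
import Data.Nat.Properties as ℕ

module _ {p q d s K n : ℕ} .{{q≢0 : NonZero q}} .{{d≢0 : NonZero d}} .{{s≢0 : NonZero s}} .{{K≢0 : NonZero K}}
         {ε : ℚ} (ε*K≡s : ε * ℕ→ℚ K ≡ ℕ→ℚ s) where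

  open Combinatorial.Construction p q d
  open Rational

  blowup-density : p ≤ℕ q → n ≥ suc (K ℕ.* (1 ℕ.+ M)) →
    (+ p / q - ε) * ℕ→ℚ (n C 2) ≤ ℕ→ℚ (edges (blowup {n})) × ℕ→ℚ (edges (blowup {n})) ≤ (+ p / q + ε) * ℕ→ℚ (n C 2)
  blowup-density p≤q n≥n₀ =
      difference-fractions-*-≤ {+ p / q} {ε} {q} {K} {p} {s} (/-*-cancel p q) ε*K≡s {edges (blowup {n})} {n C 2} (proj₁ window)
    , ≤-sum-fractions-* {+ p / q} {ε} {q} {K} {p} {s} (/-*-cancel p q) ε*K≡s {edges (blowup {n})} {n C 2} (proj₂ window)
    where
    window : p ℕ.* K ℕ.* (n C 2) ≤ℕ edges (blowup {n}) ℕ.* (q ℕ.* K) ℕ.+ s ℕ.* q ℕ.* (n C 2)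
           × edges (blowup {n}) ℕ.* (q ℕ.* K) ≤ℕ (p ℕ.* K ℕ.+ s ℕ.* q) ℕ.* (n C 2)
    window = Combinatorial.density-window {p} {q} {s} {K} {M} {edges (blowup {n})} {n} p≤q n≥n₀ (edges-≤ {n} p≤q) (edges-≥ {n} p≤q)

  -- Since `s ≥ 1`, ε is at least `1 / K`: a set of size at least `ε * n` has at least `n / K`
  -- elements, and fewer than `n / K` common neighbours are fewer than `ε * n`. The combinatorial
  -- statement at `1 / K` therefore suffices.
  blowup-spread : 8 ℕ.* (K ℕ.* K ℕ.* K) ℕ.* (q ℕ.* q) <ℕ d → n ≥ M → (U : Subset n) → ε * ℕ→ℚ n ≤ ℕ→ℚ ∣ U ∣ →
    Σ (Fin q → Fin n) λ f → Injective _≡_ _≡_ f × (∀ i → f i ∈ U)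
    × ((g : Fin (suc p) → Fin q) → Injective _≡_ _≡_ g →
    ℕ→ℚ (commonNbrs (blowup {n}) (λ j → f (g j))) < ε * ℕ→ℚ n)
  blowup-spread large M≤n U dense =
    let f , f-injective , f∈U , few = spread-subset {n} K large M≤n U n≤K∣U∣
    in f , f-injective , f∈U , λ g g-injective →
      <-fraction-* {ε} {K} {s} ε*K≡s {commonNbrs (blowup {n}) (λ j → f (g j))} {n} (scale (few g g-injective))
    where
    open ℕ.≤-Reasoning
    n≤K∣U∣ : n ≤ℕ K ℕ.* ∣ U ∣
    n≤K∣U∣ = begin
      n            ≤⟨ ℕ.m≤n*m n s ⟩
      s ℕ.* n      ≤⟨ fraction-*-≤ {ε} {K} {s} ε*K≡s {∣ U ∣} {n} dense ⟩
      ∣ U ∣ ℕ.* K  ≡⟨ ℕ.*-comm ∣ U ∣ K ⟩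
      K ℕ.* ∣ U ∣  ∎
    scale : ∀ {c} → K ℕ.* c <ℕ n → c ℕ.* K <ℕ s ℕ.* n
    scale {c} Kc<n = begin-strict
      c ℕ.* K  ≡⟨ ℕ.*-comm c K ⟩
      K ℕ.* c  <⟨ Kc<n ⟩
      n        ≤⟨ ℕ.m≤n*m n s ⟩
      s ℕ.* n  ∎

theorem1p2 : (p q : ℕ) → .{{_ : NonZero q}} → 1 ≤ℕ p → p <ℕ q →
    (ε : ℚ) → Positive ε →
    Σ ℕ λ n₀ → (n : ℕ) → n ≥ n₀ →
    Σ (Graph n) λ G →
    ((+ p / q - ε) * ℕ→ℚ (n C 2) ≤ ℕ→ℚ (edges G)
    × ℕ→ℚ (edges G) ≤ (+ p / q + ε) * ℕ→ℚ (n C 2))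
    × ((U : Subset n) → ε * ℕ→ℚ n ≤ ℕ→ℚ ∣ U ∣ →
    Σ (Fin q → Fin n) λ f → Injective _≡_ _≡_ f × (∀ i → f i ∈ U)
    × ((g : Fin (suc p) → Fin q) → Injective _≡_ _≡_ g →
    ℕ→ℚ (commonNbrs G (λ j → f (g j))) < ε * ℕ→ℚ n))
theorem1p2 p q 1≤p p<q ε@(mkℚ +[1+ s-1 ] K-1 _) _ =
  -- This makes `K (1 + M) < n`, as the density estimate demands, and also ensures `n ≥ M` for the
  -- rounding to whole blocks.
  suc (K ℕ.* (1 ℕ.+ M)) , λ n n≥n₀ →
    blowup , blowup-density {p} {q} {d} {s} {K} {n} {ε} ε*K≡s (ℕ.<⇒≤ p<q) n≥n₀
           , blowup-spread {p} {q} {d} {s} {K} {n} {ε} ε*K≡s ℕ.≤-refl (ℕ.≤-trans M≤n₀ n≥n₀)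
  where
  -- Positivity exposes ε as `s / K` with both numbers successors, hence nonzero.
  s K d : ℕ
  s = suc s-1
  K = suc K-1
  -- The least word length meeting the strict bound behind `2 K t < d`.
  d = suc (8 ℕ.* (K ℕ.* K ℕ.* K) ℕ.* (q ℕ.* q))

  open Combinatorial.Construction p q d using (M; blowup)

  ε*K≡s : ε * ℕ→ℚ K ≡ ℕ→ℚ s
  ε*K≡s = trans (cong (_* ℕ→ℚ K) (≡-sym (↥p/↧p≡p ε))) (Rational./-*-cancel s K)

  M≤n₀ : M ≤ℕ suc (K ℕ.* (1 ℕ.+ M))
  M≤n₀ = ℕ.m≤n⇒m≤1+n (ℕ.≤-trans (ℕ.n≤1+n M) (ℕ.m≤n*m (1 ℕ.+ M) K))
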